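{- Let $\mathbf{G}$ be a group (possibly non-commutative) with identity $1_{\mathbf{G}}$, and let $f:W\to\mathbf{G}$ be a $\mathbf{G}$-valued reciprocity function. For $(p,q)\in W$, choose integers $a_0,\dots,a_n$ ($n\ge 0$) with $$q=Q^{(n)}(a_0,\dots,a_n),\qquad p=P^{(n)}(a_0,\dots,a_n),$$ for $i=1,\dots,n$ put $q_i:=Q^{(n-i)}(a_i,\dots,a_n)$, $p_i:=P^{(n-i)}(a_i,\dots,a_n)$, and define $$\mathcal{D}(p,q):=f(p_1,q_1)^{ -1}f(p_2,q_2)^{ -1}\cdots f(p_n,q_n)^{ -1}\in\mathbf{G}$$ (the empty product, for $n=0$, being $1_{\mathbf{G}}$). Then: (i) $\mathcal{D}(p,q)$ depends only on $(p,q)$ and not on the choice of the sequence $(a_0,\dots,a_n)$; (ii) the function $\mathcal{D}:W\to\mathbf{G}$ thus defined is a generalized $\mathbf{G}$-valued Dedekind symbol with reciprocity function $f$.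
   Context: $W:=\{(p,q)\in\mathbb{Z}\times\mathbb{Z} : \gcd(p,q)=1\}$. A $\mathbf{G}$-valued reciprocity function is a map $f:W\to\mathbf{G}$ such that for all relevant $(p,q)$: $f(p,-q)=f(-p,q)$; $f(p,q)f(-q,p)=1_{\mathbf{G}}$; and $f(p,p+q)f(p+q,q)=f(p,q)$. Given such $f$, a generalized $\mathbf{G}$-valued Dedekind symbol with reciprocity function $f$ is a map $\mathcal{D}:W\to\mathbf{G}$ such that $\mathcal{D}(p,q)=\mathcal{D}(p,q+p)$, $\mathcal{D}(p,-q)=\mathcal{D}(-p,q)$, and $\mathcal{D}(p,q)\mathcal{D}(q,-p)^{ -1}=f(p,q)$ for all $(p,q)\in W$. The polynomials $Q^{(n)},P^{(n)}\in\mathbb{Z}[A_0,\dots,A_n]$ in commuting variables are defined inductively by $Q^{(0)}(A_0)=A_0$, $P^{(0)}(A_0)=1$, and $Q^{(n+1)}(A_0,\dots,A_{n+1})=A_0Q^{(n)}(A_1,\dots,A_{n+1})-P^{(n)}(A_1,\dots,A_{n+1})$, $P^{(n+1)}(A_0,\dots,A_{n+1})=Q^{(n)}(A_1,\dots,A_{n+1})$; thus $Q^{(n)}/P^{(n)}$ is the continued fraction $A_0-\cfrac{1}{A_1-\cfrac{1}{\ddots-\cfrac{1}{A_n}}}$. The paper assumes every $(p,q)\in W$ admits such a presentation $(a_0,\dots,a_n)$. -}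

module Defs where

open import Algebra.Bundles using (Group)
open import Data.Integer using (ℤ; 0ℤ; 1ℤ; +_; -[1+_]; ∣_∣; _+_; _-_; _*_; -_; NonZero)
open import Data.Integer.Divisibility.Signed
open import Data.Integer.DivMod using (_/_; _%_; n%d<d; a≡a%n+[a/n]*n)
open import Data.Integer.GCD using (gcd; gcd[i,j]∣i; gcd[i,j]∣j; gcd-zeroˡ)
open import Data.Integer.Properties using (∣-i∣≡∣i∣; neg-involutive; +-injective)
open import Data.Integer.Solver using (module +-*-Solver)
open import Data.Nat as ℕ using (ℕ; zero; suc)
import Data.Nat.Divisibility as ℕ
import Data.Nat.GCD as ℕ
open import Data.Nat.Induction using (<-wellFounded)
open import Data.Product using (Σ-syntax; _×_; _,_; proj₁; proj₂)
open import Data.Vec using (Vec; []; _∷_; map; foldr′)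
open import Induction.WellFounded using (Acc; acc)
open import Level using (Level; _⊔_)
open import Relation.Binary.PropositionalEquality

private
  variable
    c ℓ : Level

-- Wrapping the equation lets p and q be inferred from the type.  The field is
-- irrelevant, as in ℚ, so elements of W with equal components are equal.
record Coprime (p q : ℤ) : Set where
  constructor coprime
  field
    .gcd≡1 : gcd p q ≡ 1ℤ

W : Set
W = Σ[ (p , q) ∈ ℤ × ℤ ] Coprime p q

module _ {p q : ℤ} where

  private
    -- coprimality passes to any pair whose common divisors divide p and q
    transfer : ∀ {r s} → (∀ {d} → d ∣ r → d ∣ s → (d ∣ p) × (d ∣ q)) →
               Coprime p q → Coprime r s
    transfer {r} {s} k (coprime h) = coprime (cong +_ (ℕ.∣1⇒≡1
      (subst (ℕ.gcd ∣ r ∣ ∣ s ∣ ℕ.∣_) (+-injective h)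
        (ℕ.gcd-greatest (∣⇒∣ᵤ (proj₁ common)) (∣⇒∣ᵤ (proj₂ common))))))
      where
      common : (gcd r s ∣ p) × (gcd r s ∣ q)
      common = k (∣ᵤ⇒∣ {gcd r s} {r} (gcd[i,j]∣i r s)) (∣ᵤ⇒∣ {gcd r s} {s} (gcd[i,j]∣j r s))

    ∣-⇒∣ : ∀ {d} i → d ∣ - i → d ∣ i
    ∣-⇒∣ {d} i d∣-i = subst (d ∣_) (neg-involutive i) (∣m⇒∣-m d∣-i)

  coprime-swap : Coprime p q → Coprime q p
  coprime-swap = transfer λ d∣q d∣p → d∣p , d∣q

  coprime-negʳ : Coprime p q → Coprime p (- q)
  coprime-negʳ = transfer λ d∣p d∣-q → d∣p , ∣-⇒∣ q d∣-q

  coprime-negˡ : Coprime p q → Coprime (- p) q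
  coprime-negˡ = transfer λ d∣-p d∣q → ∣-⇒∣ p d∣-p , d∣q

  coprime-p,p+q : Coprime p q → Coprime p (p + q)
  coprime-p,p+q = transfer λ d∣p d∣p+q → d∣p , ∣m+n∣m⇒∣n d∣p+q d∣p

  coprime-p+q,q : Coprime p q → Coprime (p + q) q
  coprime-p+q,q = transfer λ d∣p+q d∣q → ∣m+n∣n⇒∣m d∣p+q d∣q , d∣q

  coprime-p,q+p : Coprime p q → Coprime p (q + p)
  coprime-p,q+p = transfer λ d∣p d∣q+p → d∣p , ∣m+n∣n⇒∣m d∣q+p d∣p

  coprime-q,aq-p : ∀ a → Coprime p q → Coprime q (a * q - p)
  coprime-q,aq-p a = transfer λ d∣q d∣aq-p →
    ∣-⇒∣ p (∣m+n∣m⇒∣n d∣aq-p (∣n⇒∣m*n a d∣q)) , d∣q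

module _ (G : Group c ℓ) where
  open Group G

  record IsReciprocityFunction (f : W → Carrier) : Set (c ⊔ ℓ) where
    field
      f-neg        : ∀ p q (h : Coprime p q) →
                     f ((p , - q) , coprime-negʳ h) ≈ f ((- p , q) , coprime-negˡ h)
      f-reciprocal : ∀ p q (h : Coprime p q) →
                     f ((p , q) , h) ∙ f ((- q , p) , coprime-negˡ (coprime-swap h)) ≈ ε
      f-sum        : ∀ p q (h : Coprime p q) →
                     f ((p , p + q) , coprime-p,p+q h) ∙ f ((p + q , q) , coprime-p+q,q h)
                       ≈ f ((p , q) , h)

  record IsDedekindSymbol (f D : W → Carrier) : Set (c ⊔ ℓ) where
    field
      D-shift       : ∀ p q (h : Coprime p q) →
                      D ((p , q) , h) ≈ D ((p , q + p) , coprime-p,q+p h)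
      D-neg         : ∀ p q (h : Coprime p q) →
                      D ((p , - q) , coprime-negʳ h) ≈ D ((- p , q) , coprime-negˡ h)
      D-reciprocity : ∀ p q (h : Coprime p q) →
                      D ((p , q) , h) ∙ D ((q , - p) , coprime-negʳ (coprime-swap h)) ⁻¹
                        ≈ f ((p , q) , h)

-- The polynomials Q⁽ⁿ⁾, P⁽ⁿ⁾ ∈ ℤ[A₀, …, Aₙ] occur only through their values at
-- integer points, so they are given as functions of (a₀, …, aₙ).
Q P : ∀ n → Vec ℤ (suc n) → ℤ
Q zero    (a ∷ [])  = a
Q (suc n) (a ∷ as)  = a * Q n as - P n as
P zero    (a ∷ [])  = 1ℤ
P (suc n) (a ∷ as)  = Q n as

P,Q-coprime : ∀ n as → Coprime (P n as) (Q n as)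
P,Q-coprime zero    (a ∷ [])  = coprime (gcd-zeroˡ a)
P,Q-coprime (suc n) (a ∷ as)  = coprime-q,aq-p a (P,Q-coprime n as)

-- (p₁ , q₁), …, (pₙ , qₙ), where the i-th pair is
-- (P⁽ⁿ⁻ⁱ⁾(aᵢ, …, aₙ) , Q⁽ⁿ⁻ⁱ⁾(aᵢ, …, aₙ)).
convergents : ∀ n → Vec ℤ (suc n) → Vec W n
convergents zero    _         = []
convergents (suc n) (_ ∷ as)  = ((P n as , Q n as) , P,Q-coprime n as) ∷ convergents n as

record Presentation (w : W) : Set where
  constructor presentation
  field
    n   : ℕ
    as  : Vec ℤ (suc n)
    q≡Q : let ((p , q) , _) = w in q ≡ Q n as
    p≡P : let ((p , q) , _) = w in p ≡ P n as

module _ (G : Group c ℓ) (f : W → Group.Carrier G) where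
  open Group G

  symbol : ∀ {w} → Presentation w → Carrier
  symbol x = foldr′ _∙_ ε (map (λ wᵢ → f wᵢ ⁻¹) (convergents n as))
    where open Presentation x

-- Presentations always exist, so quantifying over choice functions
-- (w : W) → Presentation w is not vacuous.
present : ∀ w → Presentation w
present ((p , q) , h) = go p q h (<-wellFounded ∣ p ∣)
  where
  extend : ∀ a {p q} {h : Coprime p q} {h′ : Coprime (a * p - q) p} →
           Presentation ((a * p - q , p) , h′) → Presentation ((p , q) , h)
  extend a {p} {q} (presentation n as q≡ p≡) = presentation (suc n) (a ∷ as)
    (trans (solve 2 (λ t q → q := t :- (t :- q)) refl (a * p) q)
           (cong₂ (λ s t → a * s - t) q≡ p≡))
    q≡
    where open +-*-Solver

  smaller : ∀ p q .{{_ : NonZero p}} → ∣ (q / p) * p - q ∣ ℕ.< ∣ p ∣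
  smaller p q = subst (ℕ._< ∣ p ∣)
    (sym (trans (cong ∣_∣ ≡-r) (∣-i∣≡∣i∣ (+ (q % p))))) (n%d<d q p)
    where
    open +-*-Solver
    ≡-r : (q / p) * p - q ≡ - (+ (q % p))
    ≡-r = trans (cong (λ t → (q / p) * p - t) (a≡a%n+[a/n]*n q p))
                (solve 2 (λ r t → t :- (r :+ t) := :- r) refl (+ (q % p)) ((q / p) * p))

  go : ∀ p q (h : Coprime p q) → Acc ℕ._<_ ∣ p ∣ → Presentation ((p , q) , h)
  go (+ zero)       (+ 1)            _ _        = presentation 3 (0ℤ ∷ 0ℤ ∷ 0ℤ ∷ 0ℤ ∷ []) refl refl
  go (+ zero)       -[1+ 0 ]         _ _        = presentation 1 (0ℤ ∷ 0ℤ ∷ []) refl refl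
  go (+ zero)       (+ 0)            (coprime ())
  go (+ zero)       (+ suc (suc _))  (coprime ())
  go (+ zero)       -[1+ suc _ ]     (coprime ())
  go p@(+ suc _)    q                h (acc rs) = extend (q / p)
    (go _ p (coprime-swap (coprime-q,aq-p (q / p) (coprime-swap h))) (rs (smaller p q)))
  go p@(-[1+ _ ])   q                h (acc rs) = extend (q / p)
    (go _ p (coprime-swap (coprime-q,aq-p (q / p) (coprime-swap h))) (rs (smaller p q)))

{-# OPTIONS --safe #-}
module Submission where

-- The value of D is forced by Euclid's algorithm in its subtractive form:
-- E(p, q) := D(p, -q) for p, q ≥ 0 must satisfy E(p, p + r) = E(p, r) and
-- E(s + t, s) = f(s + t, t) E(t, s).  Taking these as the definition of E, the
-- relation f(p, p + q) f(p + q, q) = f(p, q) is exactly what makes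
-- D(p, q) := f(p, q) E(q, p), D(p, -q) := E(p, q) invariant under q ↦ q + p.
-- A presentation merely unwinds the laws of D, starting from D(1, a) = 1, so
-- its symbol is the value of D.  Coprimality plays no role: extended by ε to
-- all of ℤ × ℤ, f keeps its three laws.

open import Defs
open import Algebra.Bundles using (Group)
open import Algebra.Properties.Group using (identityʳ-unique; \\-leftDividesʳ; //-rightDividesʳ)
open import Data.Integer using (ℤ; 0ℤ; 1ℤ; +_; -[1+_]; _⊖_; _+_; _-_; _*_; -_)
open import Data.Integer.GCD using (gcd)
open import Data.Integer.Properties as ℤ using (neg-involutive)
open import Data.Integer.Solver using (module +-*-Solver)
open import Data.Nat as ℕ using (ℕ; zero; suc; _≤_; _<_; _∸_)
import Data.Nat.Properties as ℕ
open import Data.Nat.Induction using (<-wellFounded)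
open import Data.Product using (_×_; _,_; uncurry)
open import Data.Sum using (inj₁; inj₂)
open import Data.Vec using ([]; _∷_)
open import Function using (_on_)
open import Induction.WellFounded using (WellFounded; WfRec; module All; module FixPoint)
open import Level using (Level)
open import Relation.Binary.Construct.On using (wellFounded)
open import Relation.Binary.PropositionalEquality as ≡ using (_≡_; cong; cong₂; subst)
open import Relation.Nullary using (¬_; Dec; yes; no; contradiction)
open import Relation.Nullary.Decidable as Dec using (recompute)

private
  variable
    c ℓ : Level
    p q : ℤ

-- Termination measure and converses for coprimality.

-- The sum of the coordinates drops at each subtraction, whichever coordinate is reduced.
_≺_ : ℕ × ℕ → ℕ × ℕ → Set
_≺_ = _<_ on uncurry ℕ._+_

≺-wellFounded : WellFounded _≺_
≺-wellFounded = wellFounded (uncurry ℕ._+_) <-wellFounded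

-- In the negative case the irrelevant field has to become an actual proof; `recompute` recovers it
-- from the decidability of equality on ℤ.
coprime? : ∀ p q → Dec (Coprime p q)
coprime? p q = Dec.map′ (λ e → coprime e) (λ (coprime e) → recompute (gcd p q ℤ.≟ 1ℤ) e) (gcd p q ℤ.≟ 1ℤ)

coprime-neg⁻ʳ : Coprime p (- q) → Coprime p q
coprime-neg⁻ʳ {p} {q} h = subst (Coprime p) (neg-involutive q) (coprime-negʳ h)

coprime-neg⁻ˡ : Coprime (- p) q → Coprime p q
coprime-neg⁻ˡ h = coprime-swap (coprime-neg⁻ʳ (coprime-swap h))

-- Negating the second entry turns adding `p` into subtracting it: `p - (p + q) = - q`.
coprime-p,p+q⁻ : Coprime p (p + q) → Coprime p q
coprime-p,p+q⁻ {p} {q} h = coprime-neg⁻ʳ (subst (Coprime p)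
  (solve 2 (λ p q → p :+ :- (p :+ q) := :- q) ≡.refl p q)
  (coprime-p,p+q (coprime-negʳ h)))
  where open +-*-Solver

coprime-p+q,q⁻ : Coprime (p + q) q → Coprime p q
coprime-p+q,q⁻ {p} {q} h = coprime-swap (coprime-p,p+q⁻
  (subst (Coprime q) (ℤ.+-comm p q) (coprime-swap h)))

module _ (G : Group c ℓ) where
  open Group G hiding (_-_)
  open import Relation.Binary.Reasoning.Setoid setoid

  -- The symbol of a function on ℤ × ℤ with the three laws.

  module DedekindSymbol (F : ℤ → ℤ → Carrier)
    (F-neg        : ∀ p q → F p (- q) ≈ F (- p) q)
    (F-reciprocal : ∀ p q → F p q ∙ F (- q) p ≈ ε)
    (F-sum        : ∀ p q → F p (p + q) ∙ F (p + q) q ≈ F p q)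
    where

    -- The sum law at `(0 , n)` reads `F 0ℤ n ∙ F n n ≈ F 0ℤ n`; cancel.
    F-diagonal : ∀ n → F n n ≈ ε
    F-diagonal n = identityʳ-unique G (F 0ℤ n) (F n n)
      (subst (λ m → F 0ℤ m ∙ F m n ≈ F 0ℤ n) (ℤ.+-identityˡ n) (F-sum 0ℤ n))

    F-axes : ∀ n → F n 0ℤ ∙ F 0ℤ n ≈ ε
    F-axes n = F-reciprocal n 0ℤ

    -- Subtractive Euclid: `E` and its recursion laws.

    private
      Value : ℕ × ℕ → Set _
      Value _ = Carrier

      -- The comparison is an argument, so that proofs about an unfolded `E` can split on it.
      -- Cancelling the two successors, `q ∸ p` is the difference of `suc q` and `suc p`.
      subtract : ∀ p q → Dec (suc p ≤ suc q) → WfRec _≺_ Value (suc p , suc q) → Carrier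
      subtract p q (yes _)  rec = rec {suc p , q ∸ p} (ℕ.+-monoʳ-< (suc p) (ℕ.s≤s (ℕ.m∸n≤m q p)))
      subtract p q (no _)   rec = F (+ suc p) (+ (p ∸ q)) ∙
        rec {p ∸ q , suc q} (ℕ.+-monoˡ-< (suc q) (ℕ.s≤s (ℕ.m∸n≤m p q)))

      step : ∀ x → WfRec _≺_ Value x → Carrier
      -- The value `ε` normalises the symbol at `(p , 0)`. For `q > 0` the next value is forced:
      -- `D 0ℤ (- + q)`, which is `E 0 q`, must agree with `D 0ℤ (+ q)`, which is
      -- `F 0ℤ (+ q) ∙ E q 0`.
      step (p     , zero)  rec = ε
      step (zero  , q)     rec = F 0ℤ (+ q)
      step (suc p , suc q) rec = subtract p q (suc p ℕ.≤? suc q) λ {y} → rec {y}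

      -- Unfolding a well-founded recursion requires `step` to respect pointwise equality of the
      -- recursive values.
      step-ext : ∀ x {rec rec′ : WfRec _≺_ Value x} →
                 (∀ {y} y≺x → rec {y} y≺x ≡ rec′ {y} y≺x) →
                 step x (λ {y} → rec {y}) ≡ step x (λ {y} → rec′ {y})
      step-ext (zero  , zero)  h = ≡.refl
      step-ext (suc p , zero)  h = ≡.refl
      step-ext (zero  , suc q) h = ≡.refl
      step-ext (suc p , suc q) h with suc p ℕ.≤? suc q
      ... | yes _ = h {suc p , q ∸ p} _
      ... | no _  = cong (F _ _ ∙_) (h {p ∸ q , suc q} _)

    E : ℕ → ℕ → Carrier
    E p q = All.wfRec ≺-wellFounded _ Value step (p , q)

    private
      E-unfold : ∀ p q → E p q ≡ step (p , q) (λ {y} _ → uncurry E y)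
      E-unfold p q = FixPoint.unfold-wfRec ≺-wellFounded Value step
        (λ x {rec} {rec′} → step-ext x {λ {y} → rec {y}} {λ {y} → rec′ {y}}) {p , q}

    E-zeroʳ : ∀ p → E p 0 ≡ ε
    E-zeroʳ p = E-unfold p 0

    E-zeroˡ : ∀ q → E 0 q ≈ F 0ℤ (+ q)
    E-zeroˡ zero    = trans (reflexive (E-zeroʳ 0)) (sym (F-diagonal 0ℤ))
    E-zeroˡ (suc q) = reflexive (E-unfold 0 (suc q))

    E-shiftʳ : ∀ p r → E p (p ℕ.+ r) ≡ E p r
    E-shiftʳ zero    r = ≡.refl
    E-shiftʳ (suc p) r rewrite E-unfold (suc p) (suc p ℕ.+ r)
      with suc p ℕ.≤? suc (p ℕ.+ r)
    ... | yes _ = cong (E (suc p)) (ℕ.m+n∸m≡n p r)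
    ... | no ¬le = contradiction (ℕ.m≤m+n (suc p) r) ¬le

    -- For positive `s` and `t` this is the recursion itself; the boundary cases rest on
    -- `F-diagonal` (`s = 0`) and `F-axes` (`t = 0`).
    E-shiftˡ : ∀ s t → E (s ℕ.+ t) s ≈ F (+ (s ℕ.+ t)) (+ t) ∙ E t s
    E-shiftˡ zero t = begin
      E t 0                   ≡⟨ E-zeroʳ t ⟩
      ε                       ≈⟨ F-diagonal (+ t) ⟨
      F (+ t) (+ t)           ≈⟨ identityʳ _ ⟨
      F (+ t) (+ t) ∙ ε       ≡⟨ cong (F (+ t) (+ t) ∙_) (E-zeroʳ t) ⟨
      F (+ t) (+ t) ∙ E t 0   ∎
    -- Equal arguments take the other branch of the recursion, which leads to `E s 0`, so both sides
    -- must be compared with `ε`.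
    E-shiftˡ s@(suc _) zero = subst (λ m → E m s ≈ F (+ m) 0ℤ ∙ E 0 s) (≡.sym (ℕ.+-identityʳ s)) (begin
      E s s                      ≡⟨ cong (E s) (ℕ.+-identityʳ s) ⟨
      E s (s ℕ.+ 0)              ≡⟨ E-shiftʳ s 0 ⟩
      E s 0                      ≡⟨ E-zeroʳ s ⟩
      ε                          ≈⟨ F-axes (+ s) ⟨
      F (+ s) 0ℤ ∙ F 0ℤ (+ s)    ≈⟨ ∙-congˡ (E-zeroˡ s) ⟨
      F (+ s) 0ℤ ∙ E 0 s         ∎)
    E-shiftˡ (suc s) t@(suc t′) rewrite E-unfold (suc s ℕ.+ t) (suc s)
      with suc (s ℕ.+ t) ℕ.≤? suc s
    ... | yes le = contradiction le (ℕ.<⇒≱ (ℕ.m<m+n (suc s) (ℕ.s≤s ℕ.z≤n)))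
    ... | no _  = reflexive (cong (λ k → F (+ (suc s ℕ.+ t)) (+ k) ∙ E k (suc s)) (ℕ.m+n∸m≡n s t))

    -- The symbol on all integer pairs and its laws.

    D⁺ : ℕ → ℤ → Carrier
    D⁺ p (+ q)    = F (+ p) (+ q) ∙ E q p
    D⁺ p -[1+ q ] = E p (suc q)

    D : ℤ → ℤ → Carrier
    D (+ p)    q = D⁺ p q
    D -[1+ p ] q = D⁺ (suc p) (- q)

    -- Since `- + 0` is `+ 0`, the case `q = 0` falls under the other clause of `D⁺`; there `F-axes`
    -- brings the value to `ε`.
    D⁺-neg : ∀ p q → D⁺ p (- + q) ≈ E p q
    D⁺-neg p (suc q) = refl
    D⁺-neg p zero    = begin
      F (+ p) 0ℤ ∙ E 0 p         ≈⟨ ∙-congˡ (E-zeroˡ p) ⟩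
      F (+ p) 0ℤ ∙ F 0ℤ (+ p)    ≈⟨ F-axes (+ p) ⟩
      ε                          ≡⟨ E-zeroʳ p ⟨
      E p 0                      ∎

    D⁺-zero : ∀ q → D⁺ 0 (- + q) ≈ D⁺ 0 (+ q)
    D⁺-zero q = begin
      D⁺ 0 (- + q)         ≈⟨ D⁺-neg 0 q ⟩
      E 0 q                ≈⟨ E-zeroˡ q ⟩
      F 0ℤ (+ q)           ≈⟨ identityʳ _ ⟨
      F 0ℤ (+ q) ∙ ε       ≡⟨ cong (F 0ℤ (+ q) ∙_) (E-zeroʳ q) ⟨
      F 0ℤ (+ q) ∙ E q 0   ∎

    D-neg : ∀ p q → D p (- q) ≈ D (- p) q
    D-neg (+ suc _) q          = refl
    D-neg (+ zero)  (+ q)      = D⁺-zero q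
    D-neg (+ zero)  -[1+ q ]   = sym (D⁺-zero (suc q))
    D-neg -[1+ p ]  q          = reflexive (cong (D⁺ (suc p)) (neg-involutive q))

    -- If `p = s + t`, one Euclidean step gives `F (+ p) (+ t) ∙ E t s`, and `E t s` equals `E t p`.
    -- If `s = p + r`, both sides are `E p r`.
    D⁺-shift-neg : ∀ p s → D⁺ p (- + s) ≈ D⁺ p (p ⊖ s)
    D⁺-shift-neg p s with ℕ.≤-total s p
    ... | inj₁ s≤p with t , ≡.refl ← ℕ.m≤n⇒∃[o]m+o≡n s≤p = begin
      D⁺ p (- + s)             ≈⟨ D⁺-neg p s ⟩
      E p s                    ≈⟨ E-shiftˡ s t ⟩
      F (+ p) (+ t) ∙ E t s    ≡⟨ cong (F (+ p) (+ t) ∙_) (E-shiftʳ t s) ⟨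
      F (+ p) (+ t) ∙ E t (t ℕ.+ s)    ≡⟨ cong (λ k → F (+ p) (+ t) ∙ E t k) (ℕ.+-comm t s) ⟩
      D⁺ p (+ t)               ≡⟨ cong (λ k → D⁺ p (+ k)) (ℕ.m+n∸m≡n s t) ⟨
      D⁺ p (+ (p ∸ s))         ≡⟨ cong (D⁺ p) (ℤ.⊖-≥ s≤p) ⟨
      D⁺ p (p ⊖ s)             ∎
    ... | inj₂ p≤s with r , ≡.refl ← ℕ.m≤n⇒∃[o]m+o≡n p≤s = begin
      D⁺ p (- + s)             ≈⟨ D⁺-neg p s ⟩
      E p s                    ≡⟨ E-shiftʳ p r ⟩
      E p r                    ≈⟨ D⁺-neg p r ⟨
      D⁺ p (- + r)             ≡⟨ cong (λ k → D⁺ p (- + k)) (ℕ.m+n∸m≡n p r) ⟨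
      D⁺ p (- + (s ∸ p))       ≡⟨ cong (D⁺ p) (ℤ.⊖-≤ p≤s) ⟨
      D⁺ p (p ⊖ s)             ∎

    D⁺-shift : ∀ p q → D⁺ p q ≈ D⁺ p (q + + p)
    D⁺-shift p -[1+ q ] = D⁺-shift-neg p (suc q)
    D⁺-shift p (+ q)    = begin
      F (+ p) (+ q) ∙ E q p                           ≈⟨ ∙-congʳ (F-sum (+ p) (+ q)) ⟨
      F (+ p) (+ m) ∙ F (+ m) (+ q) ∙ E q p           ≈⟨ assoc _ _ _ ⟩
      F (+ p) (+ m) ∙ (F (+ m) (+ q) ∙ E q p)         ≈⟨ ∙-congˡ (E-shiftˡ p q) ⟨
      D⁺ p (+ m)                                      ≡⟨ cong (λ k → D⁺ p (+ k)) (ℕ.+-comm p q) ⟩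
      D⁺ p (+ (q ℕ.+ p))                              ∎
      where m = p ℕ.+ q

    D-shift : ∀ p q → D p q ≈ D p (q + p)
    D-shift (+ p)        q = D⁺-shift p q
    D-shift p@(-[1+ n ]) q = begin
      D⁺ (suc n) (- q)          ≈⟨ D⁺-shift (suc n) (- q) ⟩
      D⁺ (suc n) (- q + - p)    ≡⟨ cong (D⁺ (suc n)) (ℤ.neg-distrib-+ q p) ⟨
      D⁺ (suc n) (- (q + p))    ∎

    D-shift* : ∀ a p q → D p q ≈ D p (a * p + q)
    D-shift* (+ n) p q = go n
      where
      open +-*-Solver
      go : ∀ n → D p q ≈ D p (+ n * p + q)
      go zero    = reflexive (cong (D p) (solve 2 (λ p q → q := con 0ℤ :* p :+ q) ≡.refl p q))
      go (suc n) = begin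
        D p q                       ≈⟨ go n ⟩
        D p (+ n * p + q)           ≈⟨ D-shift p _ ⟩
        D p (+ n * p + q + p)       ≡⟨ cong (D p) (solve 3 (λ n p q → n :* p :+ q :+ p := (con 1ℤ :+ n) :* p :+ q) ≡.refl (+ n) p q) ⟩
        D p (+ suc n * p + q)       ∎
    -- Shifting back from the target uses the positive multiplier `- a`, hence the first clause.
    D-shift* a@(-[1+ n ]) p q = begin
      D p q                           ≡⟨ cong (D p) (solve 3 (λ a p q → q := :- a :* p :+ (a :* p :+ q)) ≡.refl a p q) ⟩
      D p (- a * p + (a * p + q))     ≈⟨ D-shift* (- a) p (a * p + q) ⟨
      D p (a * p + q)                 ∎
      where open +-*-Solver

    D⁺-reciprocity : ∀ p q → D⁺ p q ≈ F (+ p) q ∙ D q (- + p)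
    D⁺-reciprocity p (+ q)        = ∙-congˡ (sym (D⁺-neg q p))
    D⁺-reciprocity p q@(-[1+ n ]) = begin
      -- The inserted `F (+ p) q ∙ F (- q) (+ p)` supplies the factor that `D (- q) (+ p)` has in
      -- front of `E p (suc n)`, as `- q` is positive.
      E p (suc n)                               ≈⟨ identityˡ _ ⟨
      ε ∙ E p (suc n)                           ≈⟨ ∙-congʳ (F-reciprocal (+ p) q) ⟨
      F (+ p) q ∙ F (- q) (+ p) ∙ E p (suc n)   ≈⟨ assoc _ _ _ ⟩
      F (+ p) q ∙ D (- q) (+ p)                 ≡⟨ cong (λ r → F (+ p) q ∙ D (- q) r) (neg-involutive (+ p)) ⟨
      F (+ p) q ∙ D q (- + p)                   ∎

    D-reciprocity : ∀ p q → D p q ≈ F p q ∙ D q (- p)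
    D-reciprocity (+ p)        q = D⁺-reciprocity p q
    D-reciprocity p@(-[1+ n ]) q = begin
      D⁺ (suc n) (- q)                ≈⟨ D⁺-reciprocity (suc n) (- q) ⟩
      F (- p) (- q) ∙ D (- q) p       ≈⟨ ∙-cong (F-neg (- p) q) (sym (D-neg q p)) ⟩
      F p q ∙ D q (- p)               ∎

    -- The symbol along a continued fraction.

    -- Putting `a` in front of a continued fraction replaces `(p , q)` by `(q , a * q - p)`; the new
    -- factor cancels the one from reciprocity.
    D-continue : ∀ a p q → F p q ⁻¹ ∙ D p q ≈ D q (a * q - p)
    D-continue a p q = begin
      F p q ⁻¹ ∙ D p q                    ≈⟨ ∙-congˡ (D-reciprocity p q) ⟩
      F p q ⁻¹ ∙ (F p q ∙ D q (- p))      ≈⟨ \\-leftDividesʳ G _ _ ⟩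
      D q (- p)                           ≈⟨ D-shift* a q (- p) ⟩
      D q (a * q - p)                     ∎

    -- The pair `(1 , a)` continues `(0 , 1)`, and `D 0ℤ 1ℤ` is `F 0ℤ 1ℤ` up to the trivial factor
    -- `E 1 0`. This is the value for sequences of length one.
    D-one : ∀ a → D 1ℤ a ≈ ε
    D-one a = begin
      D 1ℤ a                        ≡⟨ cong (D 1ℤ) (solve 1 (λ a → a := a :* con 1ℤ :- con 0ℤ) ≡.refl a) ⟩
      D 1ℤ (a * 1ℤ - 0ℤ)            ≈⟨ D-continue a 0ℤ 1ℤ ⟨
      F 0ℤ 1ℤ ⁻¹ ∙ (F 0ℤ 1ℤ ∙ E 1 0)  ≈⟨ \\-leftDividesʳ G _ _ ⟩
      E 1 0                         ≡⟨ E-zeroʳ 1 ⟩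
      ε                             ∎
      where open +-*-Solver

  -- Extending a reciprocity function to all integer pairs.

  module _ (f : W → Carrier) where

    -- Kept folded, so that `with coprime? p q` leaves the values of F alone.
    opaque
      extendByε : ℤ → ℤ → Carrier
      extendByε p q with coprime? p q
      ... | yes h = f ((p , q) , h)
      ... | no _  = ε

      extendByε-coprime : (h : Coprime p q) → extendByε p q ≡ f ((p , q) , h)
      extendByε-coprime {p} {q} h with coprime? p q
      ... | yes _ = ≡.refl
      ... | no ¬h = contradiction h ¬h

      extendByε-¬coprime : ¬ Coprime p q → extendByε p q ≡ ε
      extendByε-¬coprime {p} {q} ¬h with coprime? p q
      ... | yes h = contradiction h ¬h
      ... | no _  = ≡.refl

  module _ (f : W → Carrier) (rf : IsReciprocityFunction G f) where
    open IsReciprocityFunction rf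

    private
      F : ℤ → ℤ → Carrier
      F = extendByε f

      F≈f : (h : Coprime p q) → F p q ≈ f ((p , q) , h)
      F≈f h = reflexive (extendByε-coprime f h)

      F≈ε : ¬ Coprime p q → F p q ≈ ε
      F≈ε ¬h = reflexive (extendByε-¬coprime f ¬h)

      -- On coprime pairs this and the next two laws are those of `f`. Otherwise the converse
      -- coprimality lemmas show that no pair in the law is coprime, so every factor is `ε`.
      F-neg : ∀ p q → F p (- q) ≈ F (- p) q
      F-neg p q with coprime? p q
      ... | yes h = begin
        F p (- q)                           ≈⟨ F≈f (coprime-negʳ h) ⟩
        f ((p , - q) , coprime-negʳ h)      ≈⟨ f-neg p q h ⟩
        f ((- p , q) , coprime-negˡ h)      ≈⟨ F≈f (coprime-negˡ h) ⟨
        F (- p) q                           ∎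
      ... | no ¬h = trans (F≈ε λ h → ¬h (coprime-neg⁻ʳ h)) (sym (F≈ε λ h → ¬h (coprime-neg⁻ˡ h)))

      F-reciprocal : ∀ p q → F p q ∙ F (- q) p ≈ ε
      F-reciprocal p q with coprime? p q
      ... | yes h = trans (∙-cong (F≈f h) (F≈f (coprime-negˡ (coprime-swap h)))) (f-reciprocal p q h)
      ... | no ¬h = trans (∙-cong (F≈ε ¬h) (F≈ε λ h → ¬h (coprime-swap (coprime-neg⁻ˡ h)))) (identityˡ ε)

      F-sum : ∀ p q → F p (p + q) ∙ F (p + q) q ≈ F p q
      F-sum p q with coprime? p q
      ... | yes h = begin
        F p (p + q) ∙ F (p + q) q    ≈⟨ ∙-cong (F≈f (coprime-p,p+q h)) (F≈f (coprime-p+q,q h)) ⟩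
        _                            ≈⟨ f-sum p q h ⟩
        f ((p , q) , h)              ≈⟨ F≈f h ⟨
        F p q                        ∎
      ... | no ¬h = begin
        F p (p + q) ∙ F (p + q) q    ≈⟨ ∙-cong (F≈ε λ h → ¬h (coprime-p,p+q⁻ h)) (F≈ε λ h → ¬h (coprime-p+q,q⁻ h)) ⟩
        ε ∙ ε                        ≈⟨ identityˡ ε ⟩
        ε                            ≈⟨ F≈ε ¬h ⟨
        F p q                        ∎

    open DedekindSymbol F F-neg F-reciprocal F-sum public

    -- Presentations compute the symbol.

    -- Taking the pair to be the value of the sequence itself lets the induction on the sequence
    -- run: `D-one` starts it and `D-continue` adds a term.
    symbol≈D-P,Q : ∀ n as → symbol G f (presentation {(P n as , Q n as) , P,Q-coprime n as} n as ≡.refl ≡.refl)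
                             ≈ D (P n as) (Q n as)
    symbol≈D-P,Q zero    (a ∷ []) = sym (D-one a)
    symbol≈D-P,Q (suc n) (a ∷ as) = begin
      f ((P n as , Q n as) , P,Q-coprime n as) ⁻¹ ∙ _
        ≈⟨ ∙-cong (⁻¹-cong (sym (F≈f _))) (symbol≈D-P,Q n as) ⟩
      F (P n as) (Q n as) ⁻¹ ∙ D (P n as) (Q n as)
        ≈⟨ D-continue a (P n as) (Q n as) ⟩
      D (Q n as) (a * Q n as - P n as)
        ∎

    -- The value `D p q` is common to all presentations of the pair, which gives independence of the
    -- choice.
    symbol≈D : ∀ {h : Coprime p q} (x : Presentation ((p , q) , h)) → symbol G f x ≈ D p q
    symbol≈D (presentation n as q≡Q p≡P) =
      trans (symbol≈D-P,Q n as) (reflexive (≡.sym (cong₂ D p≡P q≡Q)))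

    symbol-isDedekindSymbol : (choose : ∀ w → Presentation w) →
                              IsDedekindSymbol G f (λ w → symbol G f (choose w))
    symbol-isDedekindSymbol choose = record
      { D-shift       = λ p q h → via (D-shift p q)
      ; D-neg         = λ p q h → via (D-neg p q)
      ; D-reciprocity = λ p q h → begin
          _ ∙ _ ⁻¹                                   ≈⟨ ∙-cong (symbol≈D (choose _)) (⁻¹-cong (symbol≈D (choose _))) ⟩
          D p q ∙ D q (- p) ⁻¹                       ≈⟨ ∙-congʳ (D-reciprocity p q) ⟩
          F p q ∙ D q (- p) ∙ D q (- p) ⁻¹           ≈⟨ //-rightDividesʳ G _ _ ⟩
          F p q                                      ≈⟨ F≈f h ⟩
          f ((p , q) , h)                            ∎
      }
      where
      via : ∀ {p q p′ q′} {h : Coprime p q} {h′ : Coprime p′ q′} → D p q ≈ D p′ q′ →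
            symbol G f (choose ((p , q) , h)) ≈ symbol G f (choose ((p′ , q′) , h′))
      via e = trans (symbol≈D (choose _)) (trans e (sym (symbol≈D (choose _))))

theorem1p8 : ∀ {c ℓ} (G : Group c ℓ) (f : W → Group.Carrier G) →
    IsReciprocityFunction G f →
    (∀ (w : W) (x y : Presentation w) → Group._≈_ G (symbol G f x) (symbol G f y))
    × (∀ (choose : ∀ (w : W) → Presentation w) →
    IsDedekindSymbol G f (λ w → symbol G f (choose w)))
theorem1p8 G f rf =
  (λ w x y → trans (symbol≈D G f rf x) (sym (symbol≈D G f rf y))) ,
  symbol-isDedekindSymbol G f rf
  where open Group G
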